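{- Let $(R_1,\mathcal L_1)$ and $(R_2,\mathcal L_2)$ be recursive rings with a recursive interpretation of a language. Let $d:R_1\to R_2$ be a recursive function and let $\phi:R_1\to R_2$ be a recursive and bijective function. If MRDP holds in $(R_2,\mathcal L_2)$, then $d$ is given by a Diophantine expression in $\phi$.
   Context: A recursive ring is a ring $R$ with a fixed recursive representation, i.e. an injection $j:R\to\mathbb N$ with recursive image for which addition and multiplication are recursive; subsets of $R^k$ are recursive / recursively enumerable if their images under $j^k$ are, and a function $R_1\to R_2$ is recursive if its translation $j_2\circ f\circ j_1^{ -1}$ is the restriction of a recursive function. A language $\mathcal L$ (constants, functions, relations; always containing a constant $0$ and equality) has a recursive interpretation in $R$ if all its functions are interpreted by recursive functions and all its relations by recursive sets. Terms are built from constants and variables using functions of $\mathcal L$; basic formulas are $(t_1,\ldots,t_k)\in R'$ with $R'\in\mathcal L$ a $k$-ary relation (possibly equality). $S\subset R^k$ is Diophantine if $S=\{\vec x\in R^k\mid\exists\vec y\in R^l\ (f_1\wedge\cdots\wedge f_r)\}$ for some basic formulas $f_i$. MRDP holds in $(R,\mathcal L)$ if every recursively enumerable $S\subset R$ is Diophantine. A map $d:R_1\to R_2$ is given by a Diophantine expression in $\phi:R_1\to R_2$ if there are basic $\mathcal L_2$-formulas $f_1,\ldots,f_n$ and an $l$ such that for all $x\in R_1$, $z\in R_2$: $d(x)=z\iff\exists\vec y\in R_2^{l},\ \forall1\le i\le n,\ f_i(\phi(x),\vec y,z)$.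
   Formalization: MRDP is assumed for recursively enumerable subsets of R^k for every k ≥ 1, not only for subsets of R; with subsets of R alone the claim fails, e.g. R_1=R_2=F_2, φ=id, d(x)=x+1, and a language with only 0, equality and all unary relations. -}

module Defs where

open import Algebra.Bundles using (Ring)
open import Data.Fin.Base using (Fin)
open import Data.List.Base using (List)
open import Data.List.Relation.Unary.All using (All)
open import Data.Nat.Base using (ℕ; zero; suc; _+_; _<_)
open import Data.Product.Base using (∃; ∃-syntax; _×_)
open import Data.Sum.Base using (_⊎_)
open import Data.Vec.Base using (Vec; []; _∷_; _++_; head; lookup; map)
open import Data.Vec.Relation.Binary.Pointwise.Inductive using (Pointwise)
open import Function.Base using (_∘_)
open import Function.Bundles using (_⇔_)
open import Function.Structures using (IsInjection)
open import Level using (Level; 0ℓ; _⊔_) renaming (suc to lsuc)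
open import Relation.Binary.PropositionalEquality.Core using (_≡_)
open import Relation.Nullary.Negation.Core using (¬_)
open import Relation.Unary using (Pred; _∈_)

private
  variable
    a b c ℓ c₁ ℓ₁ c₂ ℓ₂ : Level
    k m n : ℕ

------------------------------------------------------------------------
-- Computability over ℕ: partial recursive (μ-recursive) functions

data Code : ℕ → Set where
  zeroᶜ : Code n
  sucᶜ  : Code 1
  projᶜ : Fin n → Code n
  compᶜ : Code m → Vec (Code n) m → Code n
  recᶜ  : Code n → Code (suc (suc n)) → Code (suc n)
  minᶜ  : Code (suc n) → Code n

infix 4 _[_]⇓_

-- f [ v ]⇓ y : the partial function with code f is defined at v, with value y.
-- As usual, minimisation requires the values below the result to be defined.
data _[_]⇓_ : Code n → Vec ℕ n → ℕ → Set where
  ⇓zero : {v : Vec ℕ n} → zeroᶜ [ v ]⇓ 0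
  ⇓suc  : ∀ {x} → sucᶜ [ x ∷ [] ]⇓ suc x
  ⇓proj : ∀ {i : Fin n} {v} → projᶜ i [ v ]⇓ lookup v i
  ⇓comp : ∀ {f : Code m} {gs : Vec (Code n) m} {v ys z} →
          Pointwise (λ g y → g [ v ]⇓ y) gs ys → f [ ys ]⇓ z →
          compᶜ f gs [ v ]⇓ z
  ⇓rec0 : ∀ {f : Code n} {g v y} → f [ v ]⇓ y → recᶜ f g [ 0 ∷ v ]⇓ y
  ⇓recS : ∀ {f : Code n} {g v x y z} →
          recᶜ f g [ x ∷ v ]⇓ y → g [ x ∷ y ∷ v ]⇓ z →
          recᶜ f g [ suc x ∷ v ]⇓ z
  ⇓min  : ∀ {f : Code (suc n)} {v y} →
          (∀ {x} → x < y → ∃[ z ] f [ x ∷ v ]⇓ suc z) → f [ y ∷ v ]⇓ 0 →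
          minᶜ f [ v ]⇓ y

Recursive : (Vec ℕ k → ℕ) → Set
Recursive {k} f = ∃[ e ] (∀ v → e [ v ]⇓ f v)

RecursiveSet : Pred (Vec ℕ k) ℓ → Set ℓ
RecursiveSet S =
  ∃[ χ ] Recursive χ × (∀ v → (v ∈ S × χ v ≡ 1) ⊎ (¬ (v ∈ S) × χ v ≡ 0))

RecursivelyEnumerableSet : Pred (Vec ℕ k) ℓ → Set ℓ
RecursivelyEnumerableSet S = ∃[ e ] (∀ v → v ∈ S ⇔ (∃[ y ] e [ v ]⇓ y))

------------------------------------------------------------------------
-- Recursive rings

-- Image j S ⊆ ℕᵏ is the image of S ⊆ Aᵏ under jᵏ.
Image : {A : Set a} (j : A → ℕ) → Pred (Vec A k) ℓ → Pred (Vec ℕ k) (a ⊔ ℓ)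
Image j S v = ∃[ x ] x ∈ S × map j x ≡ v

-- g ∘ j₁ᵏ = j₂ ∘ f says that g extends j₂ ∘ f ∘ (j₁ᵏ)⁻¹.  If the jᵢ are
-- injective for setoid equalities, f is automatically a congruence.
RecursiveVia : {A : Set a} {B : Set b} (j₁ : A → ℕ) (j₂ : B → ℕ) →
               (Vec A k → B) → Set a
RecursiveVia j₁ j₂ f = ∃[ g ] Recursive g × (∀ x → g (map j₁ x) ≡ j₂ (f x))

record RecursiveRing c ℓ : Set (lsuc (c ⊔ ℓ)) where
  field
    ring : Ring c ℓ

  open Ring ring public
    using (Carrier; _≈_; 0#)
    renaming (_+_ to _+ᴿ_; _*_ to _*ᴿ_)

  field
    j           : Carrier → ℕ
    j-injection : IsInjection _≈_ _≡_ j
    j-image     : RecursiveSet {k = 1} (λ v → ∃[ x ] j x ≡ head v)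
    +-recursive : RecursiveVia {k = 2} j j λ { (x ∷ y ∷ []) → x +ᴿ y }
    *-recursive : RecursiveVia {k = 2} j j λ { (x ∷ y ∷ []) → x *ᴿ y }

module _ (R : RecursiveRing c ℓ) where
  open RecursiveRing R

  -- A subset of Rᵏ is a predicate compatible with the equality of R.
  IsSubset : Pred (Vec Carrier k) ℓ → Set (c ⊔ ℓ)
  IsSubset S = ∀ {x y} → Pointwise _≈_ x y → x ∈ S → y ∈ S

  RecursiveSubset : Pred (Vec Carrier k) ℓ → Set (c ⊔ ℓ)
  RecursiveSubset S = RecursiveSet (Image j S)

  RecursivelyEnumerable : Pred (Vec Carrier k) ℓ → Set (c ⊔ ℓ)
  RecursivelyEnumerable S = RecursivelyEnumerableSet (Image j S)

RecursiveFunction : (R₁ : RecursiveRing c₁ ℓ₁) (R₂ : RecursiveRing c₂ ℓ₂) →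
                    (RecursiveRing.Carrier R₁ → RecursiveRing.Carrier R₂) → Set c₁
RecursiveFunction R₁ R₂ f =
  RecursiveVia {k = 1} (RecursiveRing.j R₁) (RecursiveRing.j R₂) (f ∘ head)

------------------------------------------------------------------------
-- Languages

record Language a : Set (lsuc a) where
  field
    Con : Set a
    Fun : ℕ → Set a
    Rel : ℕ → Set a
    0ᴸ  : Con
    ≈ᴸ  : Rel 2

module _ (L : Language a) where
  open Language L

  data Term (n : ℕ) : Set a where
    var : Fin n → Term n
    con : Con → Term n
    app : Fun k → Vec (Term n) k → Term n

  data BasicFormula (n : ℕ) : Set a where
    rel : Rel k → Vec (Term n) k → BasicFormula n

record RecursiveInterpretation (R : RecursiveRing c ℓ) (L : Language a) :
                               Set (a ⊔ c ⊔ lsuc ℓ) where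
  open RecursiveRing R
  open Language L
  field
    ⟦_⟧ᶜ : Con → Carrier
    ⟦_⟧ᶠ : Fun k → Vec Carrier k → Carrier
    ⟦_⟧ʳ : Rel k → Pred (Vec Carrier k) ℓ

    ⟦0⟧        : ⟦ 0ᴸ ⟧ᶜ ≈ 0#
    ⟦≈⟧        : ∀ {x y} → (x ∷ y ∷ []) ∈ ⟦ ≈ᴸ ⟧ʳ ⇔ x ≈ y
    isSubset   : (P : Rel k) → IsSubset R ⟦ P ⟧ʳ
    recursiveᶠ : (f : Fun k) → RecursiveVia j j ⟦ f ⟧ᶠ
    recursiveʳ : (P : Rel k) → RecursiveSubset R ⟦ P ⟧ʳ

module _ {R : RecursiveRing c ℓ} {L : Language a}
         (I : RecursiveInterpretation R L) where
  open RecursiveRing R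
  open RecursiveInterpretation I

  mutual
    eval : Vec Carrier n → Term L n → Carrier
    eval ρ (var i)    = lookup ρ i
    eval ρ (con c)    = ⟦ c ⟧ᶜ
    eval ρ (app f ts) = ⟦ f ⟧ᶠ (evals ρ ts)

    evals : Vec Carrier n → Vec (Term L n) k → Vec Carrier k
    evals ρ []       = []
    evals ρ (t ∷ ts) = eval ρ t ∷ evals ρ ts

  Holds : Vec Carrier n → BasicFormula L n → Set ℓ
  Holds ρ (rel P ts) = evals ρ ts ∈ ⟦ P ⟧ʳ

  Diophantine : Pred (Vec Carrier k) ℓ → Set (a ⊔ c ⊔ ℓ)
  Diophantine {k} S =
    ∃[ l ] ∃ λ (fs : List (BasicFormula L (k + l))) →
      ∀ x → x ∈ S ⇔ (∃ λ (y : Vec Carrier l) → All (Holds (x ++ y)) fs)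

  -- "Every recursively enumerable set is Diophantine" is read for sets of
  -- k-tuples, for every k ≥ 1, which is what is needed to define the graph of
  -- a function.  For k = 1 only it would be a strictly weaker condition, since
  -- L need not contain addition, multiplication or a pairing function.
  MRDP : Set (a ⊔ c ⊔ lsuc ℓ)
  MRDP = ∀ {k} (S : Pred (Vec Carrier (suc k)) ℓ) →
         IsSubset R S → RecursivelyEnumerable R S → Diophantine S

module _ {R₂ : RecursiveRing c₂ ℓ₂} {L₂ : Language a}
         (I₂ : RecursiveInterpretation R₂ L₂) (R₁ : RecursiveRing c₁ ℓ₁) where
  private
    module R₁ = RecursiveRing R₁
    module R₂ = RecursiveRing R₂

  GivenByDiophantineExpression : (d φ : R₁.Carrier → R₂.Carrier) →
                                 Set (a ⊔ c₁ ⊔ c₂ ⊔ ℓ₂)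
  GivenByDiophantineExpression d φ =
    ∃[ l ] ∃ λ (fs : List (BasicFormula L₂ (suc (l + 1)))) →
      ∀ x z → (d x R₂.≈ z) ⇔
              (∃ λ (y : Vec R₂.Carrier l) → All (Holds I₂ (φ x ∷ y ++ z ∷ [])) fs)

{-# OPTIONS --safe #-}
module Submission where

-- Since φ is bijective, d ∘ φ⁻¹ is a map R₂ → R₂ with graph in R₂², and a
-- Diophantine definition of this graph is, up to the order of the variables,
-- a Diophantine expression for d in φ.  By MRDP it is enough that the graph be
-- recursively enumerable.  Its image in ℕ² consists of the pairs
-- (j₂ (φ x) , j₂ (d x)) with x ∈ R₁.  If g-φ and g-d are recursive functions
-- on ℕ that extend the translations of φ and d, this is the set of all (m , n)
-- for which some t ∈ ℕ satisfies
--   t ∈ j₁(R₁),  g-φ(t) = m  and  g-d(t) = n.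
-- The three conditions together amount to the vanishing of a single recursive
-- function of (t , m , n) (HasZeroTest), so a suitable t can be looked for by
-- minimisation (projection-re).  That a halting search has really found a zero
-- uses that computations are deterministic (⇓-deterministic).

open import Defs
open import Algebra.Bundles using (Ring)
open import Data.Fin.Base using (Fin; zero; suc; _↑ˡ_; _↑ʳ_)
open import Data.List.Base as List using (List)
open import Data.List.Relation.Unary.All using (All)
import Data.List.Relation.Unary.All as All
import Data.List.Relation.Unary.All.Properties as All
open import Data.Nat.Base using (ℕ; zero; suc; pred; _+_; _∸_; _<_)
open import Data.Nat.Properties
  using (<-cmp; n<1+n; m<1+n⇒m<n∨m≡n; ≤-antisym; m∸n≡0⇒m≤n;
         n∸n≡0; m+n≡0⇒m≡0; m+n≡0⇒n≡0; pred[m∸n]≡m∸[1+n])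
open import Data.Product.Base using (∃-syntax; _×_; _,_; proj₁; proj₂)
open import Data.Sum.Base using (_⊎_; inj₁; inj₂)
open import Data.Vec.Base using (Vec; []; _∷_; _++_; lookup)
open import Data.Vec.Properties using (lookup-++ˡ; lookup-++ʳ)
open import Data.Vec.Relation.Binary.Pointwise.Inductive using (Pointwise; []; _∷_)
open import Function.Bundles using (_⇔_; mk⇔; Equivalence)
import Function.Construct.Composition as Composition
open import Function.Definitions using (Bijective)
open import Function.Structures using (IsInjection)
open import Level using (Level)
open import Relation.Binary.Definitions using (tri<; tri≈; tri>)
open import Relation.Binary.PropositionalEquality
  using (_≡_; refl; sym; trans; cong; cong₂; subst)
open import Relation.Nullary.Negation using (contradiction)
open import Relation.Unary using (Pred; _∈_; _∩_)

private
  variable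
    a c ℓ ℓ′ c₁ ℓ₁ c₂ ℓ₂ : Level
    k m n : ℕ

------------------------------------------------------------------------
-- Determinism of computations

-- By induction on the code, and on the derivations only for recᶜ, where the
-- code stays the same.  In the case of minᶜ, two different results contradict
-- each other at the smaller one, where the body would be both 0 and positive.
mutual
  ⇓-deterministic : (e : Code n) {v : Vec ℕ n} {x y : ℕ} →
                    e [ v ]⇓ x → e [ v ]⇓ y → x ≡ y
  ⇓-deterministic zeroᶜ ⇓zero ⇓zero = refl
  ⇓-deterministic sucᶜ ⇓suc ⇓suc = refl
  ⇓-deterministic (projᶜ i) ⇓proj ⇓proj = refl
  ⇓-deterministic (compᶜ f gs) (⇓comp ps p) (⇓comp qs q)
    with refl ← ⇓-deterministics gs ps qs = ⇓-deterministic f p q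
  ⇓-deterministic (recᶜ f g) (⇓rec0 p) (⇓rec0 q) = ⇓-deterministic f p q
  ⇓-deterministic (recᶜ f g) (⇓recS p p′) (⇓recS q q′)
    with refl ← ⇓-deterministic (recᶜ f g) p q = ⇓-deterministic g p′ q′
  ⇓-deterministic (minᶜ f) {x = x} {y} (⇓min ps p) (⇓min qs q) with <-cmp x y
  ... | tri≈ _ x≡y _ = x≡y
  ... | tri< x<y _ _ with () ← ⇓-deterministic f p (proj₂ (qs x<y))
  ... | tri> _ _ y<x with () ← ⇓-deterministic f q (proj₂ (ps y<x))

  ⇓-deterministics : (gs : Vec (Code n) m) {v : Vec ℕ n} {xs ys : Vec ℕ m} →
                     Pointwise (λ g x → g [ v ]⇓ x) gs xs →
                     Pointwise (λ g y → g [ v ]⇓ y) gs ys → xs ≡ ys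
  ⇓-deterministics [] [] [] = refl
  ⇓-deterministics (g ∷ gs) (p ∷ ps) (q ∷ qs) =
    cong₂ _∷_ (⇓-deterministic g p q) (⇓-deterministics gs ps qs)

------------------------------------------------------------------------
-- Closure properties of recursive functions

⇓-resp-≡ : {e : Code n} {v : Vec ℕ n} {x y : ℕ} → x ≡ y → e [ v ]⇓ x → e [ v ]⇓ y
⇓-resp-≡ refl p = p

lookup-recursive : (i : Fin n) → Recursive (λ v → lookup v i)
lookup-recursive i = projᶜ i , λ _ → ⇓proj

∘-recursive₁ : {f : Vec ℕ 1 → ℕ} {g : Vec ℕ n → ℕ} →
               Recursive f → Recursive g → Recursive (λ v → f (g v ∷ []))
∘-recursive₁ (f , F) (g , G) =
  compᶜ f (g ∷ []) , λ v → ⇓comp (G v ∷ []) (F _)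

∘-recursive₂ : {f : Vec ℕ 2 → ℕ} {g h : Vec ℕ n → ℕ} →
               Recursive f → Recursive g → Recursive h →
               Recursive (λ v → f (g v ∷ h v ∷ []))
∘-recursive₂ (f , F) (g , G) (h , H) =
  compᶜ f (g ∷ h ∷ []) , λ v → ⇓comp (G v ∷ H v ∷ []) (F _)

1-recursive : Recursive {n} (λ _ → 1)
1-recursive = compᶜ sucᶜ (zeroᶜ ∷ []) , λ _ → ⇓comp (⇓zero ∷ []) ⇓suc

addition-recursive : Recursive {2} (λ v → lookup v zero + lookup v (suc zero))
addition-recursive = e , λ { (x ∷ y ∷ []) → computes x y }
  where
  e : Code 2
  e = recᶜ (projᶜ zero) (compᶜ sucᶜ (projᶜ (suc zero) ∷ []))

  computes : ∀ x y → e [ x ∷ y ∷ [] ]⇓ x + y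
  computes zero    y = ⇓rec0 ⇓proj
  computes (suc x) y = ⇓recS (computes x y) (⇓comp (⇓proj ∷ []) ⇓suc)

-- The recursion runs over the subtrahend, which is therefore the first argument.
monus-recursive : Recursive {2} (λ v → lookup v (suc zero) ∸ lookup v zero)
monus-recursive = e , λ { (x ∷ y ∷ []) → computes x y }
  where
  predᶜ : Code 1
  predᶜ = recᶜ zeroᶜ (projᶜ zero)

  predᶜ-computes : ∀ x → predᶜ [ x ∷ [] ]⇓ pred x
  predᶜ-computes zero    = ⇓rec0 ⇓zero
  predᶜ-computes (suc x) = ⇓recS (predᶜ-computes x) ⇓proj

  e : Code 2
  e = recᶜ (projᶜ zero) (compᶜ predᶜ (projᶜ (suc zero) ∷ []))

  computes : ∀ x y → e [ x ∷ y ∷ [] ]⇓ (y ∸ x)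
  computes zero    y = ⇓rec0 ⇓proj
  computes (suc x) y =
    ⇓recS (computes x y)
          (⇓-resp-≡ (pred[m∸n]≡m∸[1+n] y x)
                    (⇓comp (⇓proj ∷ []) (predᶜ-computes (y ∸ x))))

+-recursive : {f g : Vec ℕ n → ℕ} → Recursive f → Recursive g →
              Recursive (λ v → f v + g v)
+-recursive = ∘-recursive₂ addition-recursive

∸-recursive : {f g : Vec ℕ n → ℕ} → Recursive f → Recursive g →
              Recursive (λ v → f v ∸ g v)
∸-recursive F G = ∘-recursive₂ monus-recursive G F

------------------------------------------------------------------------
-- Zero sets of recursive functions and their projections

-- S is the zero set of a total recursive function.  This is a form of
-- recursiveness suited to minimisation, which looks for the value 0.
HasZeroTest : Pred (Vec ℕ k) ℓ → Set ℓ
HasZeroTest S = ∃[ h ] Recursive h × (∀ v → v ∈ S ⇔ h v ≡ 0)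

-- f v ≡ g v exactly when both truncated differences vanish.
≡-zeroTest : {f g : Vec ℕ k → ℕ} → Recursive f → Recursive g →
             HasZeroTest (λ v → f v ≡ g v)
≡-zeroTest {f = f} {g} F G =
  (λ v → (f v ∸ g v) + (g v ∸ f v)) ,
  +-recursive (∸-recursive F G) (∸-recursive G F) ,
  λ v → mk⇔ (difference≡0 (f v) (g v)) (difference≡0⇒≡ (f v) (g v))
  where
  difference≡0 : ∀ x y → x ≡ y → (x ∸ y) + (y ∸ x) ≡ 0
  difference≡0 x .x refl = cong₂ _+_ (n∸n≡0 x) (n∸n≡0 x)

  difference≡0⇒≡ : ∀ x y → (x ∸ y) + (y ∸ x) ≡ 0 → x ≡ y
  difference≡0⇒≡ x y eq =
    ≤-antisym (m∸n≡0⇒m≤n (m+n≡0⇒m≡0 (x ∸ y) eq))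
              (m∸n≡0⇒m≤n (m+n≡0⇒n≡0 (x ∸ y) eq))

-- S is the set of v with χ v ≡ 1, for its characteristic function χ.
recursiveSet-zeroTest : {S : Pred (Vec ℕ k) ℓ} → RecursiveSet S → HasZeroTest S
recursiveSet-zeroTest {S = S} (χ , X , χ-spec) =
  let h , H , χ≡1⇔ = ≡-zeroTest X 1-recursive
  in  h , H , λ v → Composition.equivalence (∈⇔χ≡1 v) (χ≡1⇔ v)
  where
  ∈⇔χ≡1 : ∀ v → v ∈ S ⇔ χ v ≡ 1
  ∈⇔χ≡1 v with χ-spec v
  ... | inj₁ (v∈S , χ≡1) = mk⇔ (λ _ → χ≡1) (λ _ → v∈S)
  ... | inj₂ (v∉S , χ≡0) =
    mk⇔ (λ v∈S → contradiction v∈S v∉S)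
        (λ χ≡1 → contradiction (trans (sym χ≡0) χ≡1) λ ())

preimage-zeroTest : {S : Pred (Vec ℕ 1) ℓ} {f : Vec ℕ k → ℕ} →
                    HasZeroTest S → Recursive f →
                    HasZeroTest (λ v → (f v ∷ []) ∈ S)
preimage-zeroTest {f = f} (h , H , S⇔) F =
  (λ v → h (f v ∷ [])) , ∘-recursive₁ H F , λ v → S⇔ (f v ∷ [])

∩-zeroTest : {S : Pred (Vec ℕ k) ℓ} {T : Pred (Vec ℕ k) ℓ′} →
             HasZeroTest S → HasZeroTest T → HasZeroTest (S ∩ T)
∩-zeroTest (f , F , S⇔) (g , G , T⇔) =
  (λ v → f v + g v) , +-recursive F G , λ v → mk⇔
    (λ (s , t) → cong₂ _+_ (Equivalence.to (S⇔ v) s) (Equivalence.to (T⇔ v) t))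
    (λ eq → Equivalence.from (S⇔ v) (m+n≡0⇒m≡0 (f v) eq) ,
            Equivalence.from (T⇔ v) (m+n≡0⇒n≡0 (f v) eq))

-- Positivity is phrased as in the premise of ⇓min.
positiveBelow : (h : ℕ → ℕ) (b : ℕ) →
                (∀ {x} → x < b → ∃[ z ] h x ≡ suc z) ⊎
                (∃[ y ] h y ≡ 0 × (∀ {x} → x < y → ∃[ z ] h x ≡ suc z))
positiveBelow h zero = inj₁ λ ()
positiveBelow h (suc b) with positiveBelow h b
... | inj₂ found = inj₂ found
... | inj₁ pos with h b in eq
...   | zero  = inj₂ (b , eq , pos)
...   | suc z = inj₁ λ x<1+b → extended (m<1+n⇒m<n∨m≡n x<1+b)
  where
  extended : ∀ {x} → x < b ⊎ x ≡ b → ∃[ z ] h x ≡ suc z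
  extended (inj₁ x<b)  = pos x<b
  extended (inj₂ refl) = z , eq

least-zero : (h : ℕ → ℕ) {t : ℕ} → h t ≡ 0 →
             ∃[ y ] h y ≡ 0 × (∀ {x} → x < y → ∃[ z ] h x ≡ suc z)
least-zero h {t} ht≡0 with positiveBelow h (suc t)
... | inj₂ found = found
... | inj₁ pos with () ← trans (sym ht≡0) (proj₂ (pos (n<1+n t)))

projection-re : {S : Pred (Vec ℕ (suc k)) ℓ} → HasZeroTest S →
                RecursivelyEnumerableSet (λ v → ∃[ t ] (t ∷ v) ∈ S)
projection-re {S = S} (h , (e , E) , S⇔) = minᶜ e , λ v → mk⇔ (halts v) (sound v)
  where
  halts : ∀ v → ∃[ t ] (t ∷ v) ∈ S → ∃[ y ] minᶜ e [ v ]⇓ y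
  halts v (t , tv∈S) =
    let y , hy≡0 , pos = least-zero (λ x → h (x ∷ v)) (Equivalence.to (S⇔ (t ∷ v)) tv∈S)
    in  y , ⇓min (λ x<y → let z , eq = pos x<y in z , ⇓-resp-≡ eq (E _))
                 (⇓-resp-≡ hy≡0 (E (y ∷ v)))

  sound : ∀ v → ∃[ y ] minᶜ e [ v ]⇓ y → ∃[ t ] (t ∷ v) ∈ S
  sound v (y , ⇓min _ p) =
    y , Equivalence.from (S⇔ (y ∷ v)) (⇓-deterministic e (E (y ∷ v)) p)

re-resp-⇔ : {S : Pred (Vec ℕ k) ℓ} {T : Pred (Vec ℕ k) ℓ′} →
            (∀ v → T v ⇔ S v) →
            RecursivelyEnumerableSet S → RecursivelyEnumerableSet T
re-resp-⇔ T⇔S (e , S⇔) = e , λ v → Composition.equivalence (T⇔S v) (S⇔ v)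

------------------------------------------------------------------------
-- Recursive functions between recursive rings

-- The underlying map respects the ring equalities, because j₁ respects the
-- equality of R₁ and j₂ reflects that of R₂.
recursiveFunction-cong :
  (R₁ : RecursiveRing c₁ ℓ₁) (R₂ : RecursiveRing c₂ ℓ₂)
  {f : RecursiveRing.Carrier R₁ → RecursiveRing.Carrier R₂} →
  RecursiveFunction R₁ R₂ f → ∀ {x y} →
  RecursiveRing._≈_ R₁ x y → RecursiveRing._≈_ R₂ (f x) (f y)
recursiveFunction-cong R₁ R₂ (g , _ , g-extends) {x} {y} x≈y =
  IsInjection.injective (RecursiveRing.j-injection R₂)
    (trans (sym (g-extends (x ∷ [])))
      (trans (cong (λ t → g (t ∷ []))
                   (IsInjection.cong (RecursiveRing.j-injection R₁) x≈y))
             (g-extends (y ∷ []))))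

-- The image in ℕ² of the set of all (f x , g x) with x ∈ R₁.  The search
-- variable t ranges over ℕ, and t ∈ j₁(R₁) is imposed as a condition because
-- f̂ and ĝ are arbitrary outside j₁(R₁).
jointImage-re :
  (R₁ : RecursiveRing c₁ ℓ₁) (R₂ : RecursiveRing c₂ ℓ₂)
  {f g : RecursiveRing.Carrier R₁ → RecursiveRing.Carrier R₂} →
  RecursiveFunction R₁ R₂ f → RecursiveFunction R₁ R₂ g →
  RecursivelyEnumerableSet {k = 2} λ v →
    ∃[ x ] RecursiveRing.j R₂ (f x) ∷ RecursiveRing.j R₂ (g x) ∷ [] ≡ v
jointImage-re R₁ R₂ {f} {g} (f̂ , F , f̂-extends) (ĝ , G , ĝ-extends) =
  re-resp-⇔ (λ { (m ∷ n ∷ []) → mk⇔ to from })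
    (projection-re
      (∩-zeroTest (preimage-zeroTest (recursiveSet-zeroTest R₁.j-image) first)
      (∩-zeroTest (≡-zeroTest (∘-recursive₁ F first) (lookup-recursive (suc zero)))
                  (≡-zeroTest (∘-recursive₁ G first) (lookup-recursive (suc (suc zero)))))))
  where
  module R₁ = RecursiveRing R₁
  module R₂ = RecursiveRing R₂

  first : Recursive {3} (λ v → lookup v zero)
  first = lookup-recursive zero

  to : ∀ {m n} → ∃[ x ] R₂.j (f x) ∷ R₂.j (g x) ∷ [] ≡ m ∷ n ∷ [] →
       ∃[ t ] (∃[ x ] R₁.j x ≡ t) × f̂ (t ∷ []) ≡ m × ĝ (t ∷ []) ≡ n
  to (x , refl) = R₁.j x , (x , refl) , f̂-extends (x ∷ []) , ĝ-extends (x ∷ [])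

  from : ∀ {m n} →
         ∃[ t ] (∃[ x ] R₁.j x ≡ t) × f̂ (t ∷ []) ≡ m × ĝ (t ∷ []) ≡ n →
         ∃[ x ] R₂.j (f x) ∷ R₂.j (g x) ∷ [] ≡ m ∷ n ∷ []
  from (_ , (x , refl) , refl , refl) =
    x , cong₂ (λ p q → p ∷ q ∷ []) (sym (f̂-extends (x ∷ []))) (sym (ĝ-extends (x ∷ [])))

------------------------------------------------------------------------
-- Renaming variables in terms and basic formulas

module _ {L : Language a} where
  -- The image of a term under a map of its variables, not necessarily injective.
  mutual
    renameTerm : (Fin m → Fin n) → Term L m → Term L n
    renameTerm r (var i)    = var (r i)
    renameTerm r (con c)    = con c
    renameTerm r (app f ts) = app f (renameTerms r ts)

    renameTerms : (Fin m → Fin n) → Vec (Term L m) k → Vec (Term L n) k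
    renameTerms r []       = []
    renameTerms r (t ∷ ts) = renameTerm r t ∷ renameTerms r ts

  -- The same map of variables applied to all terms of a basic formula.
  rename : (Fin m → Fin n) → BasicFormula L m → BasicFormula L n
  rename r (rel P ts) = rel P (renameTerms r ts)

module _ {R : RecursiveRing c ℓ} {L : Language a} (I : RecursiveInterpretation R L)
         {r : Fin m → Fin n} {ρ : Vec (RecursiveRing.Carrier R) m}
         {σ : Vec (RecursiveRing.Carrier R) n}
         (r-lookup : ∀ i → lookup σ (r i) ≡ lookup ρ i) where
  mutual
    eval-rename : ∀ t → eval I σ (renameTerm r t) ≡ eval I ρ t
    eval-rename (var i)    = r-lookup i
    eval-rename (con c)    = refl
    eval-rename (app f ts) =
      cong (RecursiveInterpretation.⟦_⟧ᶠ I f) (evals-rename ts)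

    evals-rename : (ts : Vec (Term L m) k) →
                   evals I σ (renameTerms r ts) ≡ evals I ρ ts
    evals-rename []       = refl
    evals-rename (t ∷ ts) = cong₂ _∷_ (eval-rename t) (evals-rename ts)

  holds-rename : ∀ F → Holds I σ (rename r F) ⇔ Holds I ρ F
  holds-rename (rel P ts) =
    mk⇔ (subst (_∈ ⟦ P ⟧ʳ) (evals-rename ts))
        (subst (_∈ ⟦ P ⟧ʳ) (sym (evals-rename ts)))
    where open RecursiveInterpretation I

  allHold-rename : (fs : List (BasicFormula L m)) →
                   All (Holds I σ) (List.map (rename r) fs) ⇔ All (Holds I ρ) fs
  allHold-rename fs =
    mk⇔ (λ hs → All.map (λ {F} → Equivalence.to (holds-rename F)) (All.map⁻ hs))
        (λ hs → All.map⁺ (All.map (λ {F} → Equivalence.from (holds-rename F)) hs))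

-- Moves the second of 2 + l variables to the last place: MRDP puts both
-- coordinates of the graph before the witnesses, whereas a Diophantine
-- expression has the value z after them.
secondToLast : ∀ {l} → Fin (2 + l) → Fin (suc (l + 1))
secondToLast         zero          = zero
secondToLast {l = l} (suc zero)    = suc (l ↑ʳ zero)
secondToLast         (suc (suc i)) = suc (i ↑ˡ 1)

lookup-secondToLast : ∀ {A : Set a} {l} (u z : A) (y : Vec A l) i →
  lookup (u ∷ y ++ z ∷ []) (secondToLast i) ≡ lookup (u ∷ z ∷ y) i
lookup-secondToLast u z y zero          = refl
lookup-secondToLast u z y (suc zero)    = lookup-++ʳ y (z ∷ []) zero
lookup-secondToLast u z y (suc (suc i)) = lookup-++ˡ y (z ∷ []) i

------------------------------------------------------------------------
-- The graph of d ∘ φ⁻¹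

lemma6p28 : ∀ {c₁ ℓ₁ a₁ c₂ ℓ₂ a₂}
    (R₁ : RecursiveRing c₁ ℓ₁) (L₁ : Language a₁) (I₁ : RecursiveInterpretation R₁ L₁)
    (R₂ : RecursiveRing c₂ ℓ₂) (L₂ : Language a₂) (I₂ : RecursiveInterpretation R₂ L₂)
    (d φ : RecursiveRing.Carrier R₁ → RecursiveRing.Carrier R₂) →
    RecursiveFunction R₁ R₂ d →
    RecursiveFunction R₁ R₂ φ →
    Bijective (RecursiveRing._≈_ R₁) (RecursiveRing._≈_ R₂) φ →
    MRDP I₂ →
    GivenByDiophantineExpression I₂ R₁ d φ
lemma6p28 R₁ L₁ I₁ R₂ L₂ I₂ d φ d-recursive φ-recursive
          (φ-injective , φ-surjective) mrdp =
  let l , fs , Graph⇔ = mrdp Graph Graph-isSubset Graph-re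
  in  l , List.map (rename secondToLast) fs , λ x z →
        Composition.equivalence (d⇔Graph x z)
        (Composition.equivalence (Graph⇔ (φ x ∷ z ∷ []))
          (mk⇔ (λ (y , hs) → y , Equivalence.from (reorder (φ x) z y fs) hs)
               (λ (y , hs) → y , Equivalence.to (reorder (φ x) z y fs) hs)))
  where
  module R₁ where
    open RecursiveRing R₁ public
    open Ring ring public using () renaming (refl to ≈-refl)
  module R₂ where
    open RecursiveRing R₂ public
    open Ring ring public using (sym; trans)

  open R₁ using () renaming (_≈_ to _≈₁_)
  open R₂ using () renaming (_≈_ to _≈₂_)

  d-cong : ∀ {x y} → x ≈₁ y → d x ≈₂ d y
  d-cong = recursiveFunction-cong R₁ R₂ d-recursive

  φ⁻¹ : R₂.Carrier → R₁.Carrier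
  φ⁻¹ u = proj₁ (φ-surjective u)

  φφ⁻¹ : ∀ u → φ (φ⁻¹ u) ≈₂ u
  φφ⁻¹ u = proj₂ (φ-surjective u) R₁.≈-refl

  φ⁻¹φ : ∀ x → φ⁻¹ (φ x) ≈₁ x
  φ⁻¹φ x = φ-injective (φφ⁻¹ (φ x))

  φ⁻¹-cong : ∀ {u v} → u ≈₂ v → φ⁻¹ u ≈₁ φ⁻¹ v
  φ⁻¹-cong u≈v =
    φ-injective (R₂.trans (φφ⁻¹ _) (R₂.trans u≈v (R₂.sym (φφ⁻¹ _))))

  Graph : Pred (Vec R₂.Carrier 2) _
  Graph (u ∷ z ∷ []) = d (φ⁻¹ u) ≈₂ z

  Graph-isSubset : IsSubset R₂ Graph
  Graph-isSubset {_ ∷ _ ∷ []} {_ ∷ _ ∷ []} (u≈u′ ∷ z≈z′ ∷ []) du≈z =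
    R₂.trans (R₂.sym (d-cong (φ⁻¹-cong u≈u′))) (R₂.trans du≈z z≈z′)

  d⇔Graph : ∀ x z → d x ≈₂ z ⇔ (φ x ∷ z ∷ []) ∈ Graph
  d⇔Graph x z = mk⇔ (R₂.trans (d-cong (φ⁻¹φ x)))
                    (R₂.trans (R₂.sym (d-cong (φ⁻¹φ x))))

  j₂-cong : ∀ {u v} → u ≈₂ v → R₂.j u ≡ R₂.j v
  j₂-cong = IsInjection.cong R₂.j-injection

  -- The image of the graph is parametrised by x ∈ R₁ through (φ x , d x).
  Graph-re : RecursivelyEnumerable R₂ Graph
  Graph-re = re-resp-⇔ (λ v → mk⇔ to from) (jointImage-re R₁ R₂ φ-recursive d-recursive)
    where
    to : ∀ {v} → v ∈ Image R₂.j Graph → ∃[ x ] R₂.j (φ x) ∷ R₂.j (d x) ∷ [] ≡ v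
    to (u ∷ z ∷ [] , du≈z , refl) =
      φ⁻¹ u , cong₂ (λ p q → p ∷ q ∷ []) (j₂-cong (φφ⁻¹ u)) (j₂-cong du≈z)

    from : ∀ {v} → ∃[ x ] R₂.j (φ x) ∷ R₂.j (d x) ∷ [] ≡ v → v ∈ Image R₂.j Graph
    from (x , eq) = φ x ∷ d x ∷ [] , d-cong (φ⁻¹φ x) , eq

  reorder : ∀ u z {l} (y : Vec R₂.Carrier l) fs →
            All (Holds I₂ (u ∷ y ++ z ∷ [])) (List.map (rename secondToLast) fs) ⇔
            All (Holds I₂ (u ∷ z ∷ y)) fs
  reorder u z y = allHold-rename I₂ (lookup-secondToLast u z y)
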